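{- (a) For every odd integer $n\ge 3$, the cycle $C_n$ is $\mathbb{Z}_n$-distance antimagic. (b) Let $k\ge 2$ and let $n_1,\ldots,n_k\ge 3$ be odd integers each of which divides $k-1$. Then $C_{n_1}\Box\cdots\Box C_{n_k}$ is $\mathbb{Z}_{n_1}\times\cdots\times\mathbb{Z}_{n_k}$-distance antimagic. In particular, for every odd prime $p$ and integer $d\ge 1$, the Cartesian product of $pd+1$ copies of $C_p$ is $\mathbb{Z}_p^{pd+1}$-distance antimagic.
   Context: $C_n$ is the cycle of length $n$; $\mathbb{Z}_m$ is the cyclic group of integers modulo $m$. The Cartesian product $G_1\Box\cdots\Box G_k$ has vertex set $V(G_1)\times\cdots\times V(G_k)$, with two tuples adjacent iff they differ in exactly one coordinate $i$ and are adjacent there in $G_i$. For a graph $G$ with $n$ vertices and an Abelian group $A$ of order $n$ (written additively), and a bijection $f:V(G)\to A$, the weight of $x$ is $w_f(x)=\sum_{y\in N(x)} f(y)$ computed in $A$ ($N(x)$ the open neighbourhood). $f$ is an $A$-distance antimagic labelling if all weights are pairwise distinct; $G$ is $A$-distance antimagic if it admits such a labelling. -}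

module Defs where

open import Algebra.Bundles using (AbelianGroup)
open import Algebra.Consequences.Propositional using (comm∧idˡ⇒id; comm∧invˡ⇒inv)
open import Data.Fin.Base using (Fin; zero; suc; toℕ)
import Data.Fin.Properties as Fin
open import Data.List.Base using (List; [_]; map; filter; foldr; allFin; cartesianProductWith)
open import Data.List.Membership.Propositional.Properties using (∈-allFin)
open import Data.List.Membership.Setoid.Properties using (∈-cartesianProductWith⁺; ∈-resp-≈)
open import Data.List.Relation.Unary.All using ([])
open import Data.List.Relation.Unary.AllPairs using ([]; _∷_)
open import Data.List.Relation.Unary.Any using (here)
open import Data.List.Relation.Unary.Enumerates.Setoid using (IsEnumeration)
open import Data.List.Relation.Unary.Unique.Propositional.Properties using (allFin⁺)
open import Data.List.Relation.Unary.Unique.Setoid using (Unique)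
open import Data.List.Relation.Unary.Unique.Setoid.Properties using (cartesianProductWith⁺)
open import Data.Nat.Base hiding (_⊔_; _/_)
open import Data.Nat.DivMod hiding (_/_)
open import Data.Nat.Divisibility using (_∤_; ∣-refl)
open import Data.Nat.Primality using (Prime; prime⇒nonTrivial)
open import Data.Nat.Properties
open import Data.Product.Base using (Σ-syntax; ∃-syntax; _×_; _,_; proj₁; proj₂)
open import Data.Sum.Base using (_⊎_; inj₁; inj₂; swap; [_,_]′)
open import Function.Base using (_∘_)
open import Function.Bundles using (Bijection)
open import Level using (0ℓ; _⊔_)
open import Relation.Binary.Bundles using (Setoid; DecSetoid)
open import Relation.Binary.Core using (Rel)
open import Relation.Binary.Definitions using (Decidable; Symmetric; _Respects₂_)
open import Relation.Binary.PropositionalEquality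
  using (_≡_; _≢_; refl; sym; trans; cong; cong₂; isEquivalence; module ≡-Reasoning)
open import Relation.Nullary.Decidable using (_×-dec_; _⊎-dec_; _→-dec_; ¬?)
open import Relation.Nullary.Negation using (¬_; contradiction)

------------------------------------------------------------------------
-- Finite simple graphs

-- Vertices form a setoid because the vertices of a k-fold product are
-- dependent functions on Fin k, to be compared pointwise.
record FiniteGraph : Set₁ where
  field
    vertexDecSetoid : DecSetoid 0ℓ 0ℓ

  open DecSetoid vertexDecSetoid public
    using (_≈_; _≟_) renaming (Carrier to Vertex; setoid to vertexSetoid)

  field
    vertices      : List Vertex
    enumeration   : IsEnumeration vertexSetoid vertices
    unique        : Unique vertexSetoid vertices
    Adjacent      : Rel Vertex 0ℓ
    adjacent?     : Decidable Adjacent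
    adjacent-resp : Adjacent Respects₂ _≈_
    adjacent-sym  : Symmetric Adjacent
    adjacent-irr  : ∀ {x y} → x ≈ y → ¬ Adjacent x y

  neighbours : Vertex → List Vertex
  neighbours x = filter (adjacent? x) vertices

------------------------------------------------------------------------
-- Group distance antimagic labellings

module _ {a ℓ} (G : FiniteGraph) (A : AbelianGroup a ℓ) where
  private
    module G = FiniteGraph G
    module A = AbelianGroup A

  -- The bijection itself forces A to have as many elements as G has vertices.
  Labelling : Set (a ⊔ ℓ)
  Labelling = Bijection G.vertexSetoid A.setoid

  weight : Labelling → G.Vertex → A.Carrier
  weight f x = foldr A._∙_ A.ε (map (Bijection.to f) (G.neighbours x))

  IsDistanceAntimagic : Labelling → Set ℓ
  IsDistanceAntimagic f = ∀ x y → ¬ x G.≈ y → ¬ weight f x A.≈ weight f y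

  DistanceAntimagic : Set (a ⊔ ℓ)
  DistanceAntimagic = Σ[ f ∈ Labelling ] IsDistanceAntimagic f

------------------------------------------------------------------------
-- Cycles

≥3⇒nonZero : ∀ {n} → 3 ≤ n → NonZero n
≥3⇒nonZero n≥3 = >-nonZero (≤-trans (s≤s z≤n) n≥3)

module _ (n : ℕ) .{{_ : NonZero n}} where

  Next : Rel (Fin n) 0ℓ
  Next x y = toℕ y ≡ suc (toℕ x) % n

  next-irr : 3 ≤ n → ∀ x → ¬ Next x x
  next-irr n≥3 x x≡ with m≤n⇒m<n∨m≡n (Fin.toℕ<n x)
  ... | inj₁ 1+x<n = 1+n≢n (sym (trans x≡ (m<n⇒m%n≡m 1+x<n)))
  ... | inj₂ 1+x≡n = <⇒≢ (≤-trans (s≤s (s≤s z≤n)) n≥3)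
    (trans (cong suc (sym x≡0)) 1+x≡n)
    where
    x≡0 : toℕ x ≡ 0
    x≡0 = trans x≡ (trans (cong (_% n) 1+x≡n) (n%n≡0 n))

Cycle : (n : ℕ) → 3 ≤ n → FiniteGraph
Cycle n n≥3 = record
  { vertexDecSetoid = Fin.≡-decSetoid n
  ; vertices        = allFin n
  ; enumeration     = ∈-allFin
  ; unique          = allFin⁺ n
  ; Adjacent        = λ x y → Next n x y ⊎ Next n y x
  ; adjacent?       = λ x y → (_ ≟ _) ⊎-dec (_ ≟ _)
  ; adjacent-resp   = (λ { refl p → p }) , (λ { refl p → p })
  ; adjacent-sym    = swap
  ; adjacent-irr    = λ { {x} refl → [ next-irr n n≥3 x , next-irr n n≥3 x ]′ }
  }
  where instance _ = ≥3⇒nonZero n≥3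

------------------------------------------------------------------------
-- Cartesian products of finitely many graphs

ΠDecSetoid : ∀ {k} → (Fin k → DecSetoid 0ℓ 0ℓ) → DecSetoid 0ℓ 0ℓ
ΠDecSetoid S = record
  { Carrier          = ∀ i → S.Carrier i
  ; _≈_              = λ x y → ∀ i → S._≈_ i (x i) (y i)
  ; isDecEquivalence = record
    { isEquivalence = record
      { refl  = λ i → S.refl i
      ; sym   = λ x≈y i → S.sym i (x≈y i)
      ; trans = λ x≈y y≈z i → S.trans i (x≈y i) (y≈z i)
      }
    ; _≟_ = λ x y → Fin.all? λ i → S._≟_ i (x i) (y i)
    }
  }
  where module S i = DecSetoid (S i)

ΠSetoid : ∀ {k} → (Fin k → DecSetoid 0ℓ 0ℓ) → Setoid 0ℓ 0ℓ
ΠSetoid S = DecSetoid.setoid (ΠDecSetoid S)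

tuples : ∀ {k} {V : Fin k → Set} → (∀ i → List (V i)) → List (∀ i → V i)
tuples {zero}  xs = [ (λ ()) ]
tuples {suc k} xs = cartesianProductWith Fin.∀-cons (xs zero) (tuples (xs ∘ suc))

module _ where
  open DecSetoid using (Carrier; setoid)

  tuples-enumeration : ∀ {k} (S : Fin k → DecSetoid 0ℓ 0ℓ) (xs : ∀ i → List (Carrier (S i))) →
                       (∀ i → IsEnumeration (setoid (S i)) (xs i)) →
                       IsEnumeration (ΠSetoid S) (tuples xs)
  tuples-enumeration {zero}  S xs enum v = here λ ()
  tuples-enumeration {suc k} S xs enum v =
    ∈-resp-≈ (ΠSetoid S)
      (λ { zero → DecSetoid.refl (S zero) ; (suc i) → DecSetoid.refl (S (suc i)) })
      (∈-cartesianProductWith⁺ (setoid (S zero)) (ΠSetoid (S ∘ suc)) (ΠSetoid S)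
        (λ { p q zero → p ; p q (suc i) → q i })
        (enum zero (v zero))
        (tuples-enumeration (S ∘ suc) (xs ∘ suc) (enum ∘ suc) (v ∘ suc)))

  tuples-unique : ∀ {k} (S : Fin k → DecSetoid 0ℓ 0ℓ) (xs : ∀ i → List (Carrier (S i))) →
                  (∀ i → Unique (setoid (S i)) (xs i)) →
                  Unique (ΠSetoid S) (tuples xs)
  tuples-unique {zero}  S xs uniq = [] ∷ []
  tuples-unique {suc k} S xs uniq =
    cartesianProductWith⁺ (setoid (S zero)) (ΠSetoid (S ∘ suc)) (ΠSetoid S)
      Fin.∀-cons (λ p → p zero , p ∘ suc)
      (uniq zero) (tuples-unique (S ∘ suc) (xs ∘ suc) (uniq ∘ suc))

-- In □-Adjacent the i-th coordinates do differ, since each factor is loopless.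
module _ {k} (G : Fin k → FiniteGraph) where
  private
    module G i = FiniteGraph (G i)

  □-Adjacent : Rel (∀ i → G.Vertex i) 0ℓ
  □-Adjacent x y = ∃[ i ] G.Adjacent i (x i) (y i) × (∀ j → j ≢ i → G._≈_ j (x j) (y j))

  □ : FiniteGraph
  □ = record
    { vertexDecSetoid = ΠDecSetoid G.vertexDecSetoid
    ; vertices        = tuples G.vertices
    ; enumeration     = tuples-enumeration G.vertexDecSetoid G.vertices G.enumeration
    ; unique          = tuples-unique G.vertexDecSetoid G.vertices G.unique
    ; Adjacent        = □-Adjacent
    ; adjacent?       = λ x y → Fin.any? λ i →
        G.adjacent? i (x i) (y i) ×-dec
        Fin.all? λ j → ¬? (j Fin.≟ i) →-dec G._≟_ j (x j) (y j)
    ; adjacent-resp   =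
        (λ y≈z (i , a , e) → i , proj₁ (G.adjacent-resp i) (y≈z i) a ,
                             λ j j≢i → S.trans j (e j j≢i) (y≈z j)) ,
        (λ x≈z (i , a , e) → i , proj₂ (G.adjacent-resp i) (x≈z i) a ,
                             λ j j≢i → S.trans j (S.sym j (x≈z j)) (e j j≢i))
    ; adjacent-sym    = λ (i , a , e) → i , G.adjacent-sym i a , λ j j≢i → S.sym j (e j j≢i)
    ; adjacent-irr    = λ x≈y (i , a , _) → G.adjacent-irr i (x≈y i) a
    }
    where module S i = DecSetoid (G.vertexDecSetoid i)

------------------------------------------------------------------------
-- The groups ℤ/n and their finite products

module _ (n : ℕ) .{{_ : NonZero n}} where
  _+ₙ_ : Fin n → Fin n → Fin n
  i +ₙ j = (toℕ i + toℕ j) mod n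

  -ₙ_ : Fin n → Fin n
  -ₙ i = (n ∸ toℕ i) mod n

  0ₙ : Fin n
  0ₙ = 0 mod n

  toℕ-mod : ∀ m → toℕ (m mod n) ≡ m % n
  toℕ-mod m = Fin.toℕ-fromℕ< (m%n<n m n)

  mod-toℕ : ∀ i → toℕ i mod n ≡ i
  mod-toℕ i = Fin.toℕ-injective (trans (toℕ-mod (toℕ i)) (m<n⇒m%n≡m (Fin.toℕ<n i)))

  mod-cong : ∀ {l m} → l % n ≡ m % n → l mod n ≡ m mod n
  mod-cong {l} {m} eq = Fin.toℕ-injective (trans (toℕ-mod l) (trans eq (sym (toℕ-mod m))))

  mod-+ : ∀ l m → (l mod n) +ₙ (m mod n) ≡ (l + m) mod n
  mod-+ l m = mod-cong (trans
    (cong₂ (λ a b → (a + b) % n) (toℕ-mod l) (toℕ-mod m))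
    (sym (%-distribˡ-+ l m n)))

  +ₙ-comm : ∀ i j → i +ₙ j ≡ j +ₙ i
  +ₙ-comm i j = cong (_mod n) (+-comm (toℕ i) (toℕ j))

  +ₙ-assoc : ∀ i j k → (i +ₙ j) +ₙ k ≡ i +ₙ (j +ₙ k)
  +ₙ-assoc i j k = begin
    (i +ₙ j) +ₙ k                           ≡⟨ cong ((i +ₙ j) +ₙ_) (mod-toℕ k) ⟨
    (i +ₙ j) +ₙ (toℕ k mod n)               ≡⟨ mod-+ (toℕ i + toℕ j) (toℕ k) ⟩
    (toℕ i + toℕ j + toℕ k) mod n           ≡⟨ cong (_mod n) (+-assoc (toℕ i) (toℕ j) (toℕ k)) ⟩
    (toℕ i + (toℕ j + toℕ k)) mod n         ≡⟨ mod-+ (toℕ i) (toℕ j + toℕ k) ⟨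
    (toℕ i mod n) +ₙ (j +ₙ k)               ≡⟨ cong (_+ₙ (j +ₙ k)) (mod-toℕ i) ⟩
    i +ₙ (j +ₙ k)                           ∎
    where open ≡-Reasoning

  +ₙ-identityˡ : ∀ i → 0ₙ +ₙ i ≡ i
  +ₙ-identityˡ i = begin
    0ₙ +ₙ i               ≡⟨ cong (0ₙ +ₙ_) (mod-toℕ i) ⟨
    0ₙ +ₙ (toℕ i mod n)   ≡⟨ mod-+ 0 (toℕ i) ⟩
    toℕ i mod n           ≡⟨ mod-toℕ i ⟩
    i                     ∎
    where open ≡-Reasoning

  +ₙ-inverseˡ : ∀ i → (-ₙ i) +ₙ i ≡ 0ₙ
  +ₙ-inverseˡ i = begin
    (-ₙ i) +ₙ i                 ≡⟨ cong ((-ₙ i) +ₙ_) (mod-toℕ i) ⟨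
    (-ₙ i) +ₙ (toℕ i mod n)     ≡⟨ mod-+ (n ∸ toℕ i) (toℕ i) ⟩
    (n ∸ toℕ i + toℕ i) mod n   ≡⟨ cong (_mod n) (m∸n+n≡m (<⇒≤ (Fin.toℕ<n i))) ⟩
    n mod n                     ≡⟨ mod-cong (trans (n%n≡0 n) (sym (m<n⇒m%n≡m (>-nonZero⁻¹ n)))) ⟩
    0ₙ                          ∎
    where open ≡-Reasoning

  ℤ/ : AbelianGroup 0ℓ 0ℓ
  ℤ/ = record
    { Carrier        = Fin n
    ; _≈_            = _≡_
    ; _∙_            = _+ₙ_
    ; ε              = 0ₙ
    ; _⁻¹            = -ₙ_
    ; isAbelianGroup = record
      { isGroup = record
        { isMonoid = record
          { isSemigroup = record
            { isMagma = record { isEquivalence = isEquivalence ; ∙-cong = cong₂ _+ₙ_ }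
            ; assoc   = +ₙ-assoc
            }
          ; identity = comm∧idˡ⇒id +ₙ-comm +ₙ-identityˡ
          }
        ; inverse = comm∧invˡ⇒inv +ₙ-comm +ₙ-inverseˡ
        ; ⁻¹-cong = cong -ₙ_
        }
      ; comm = +ₙ-comm
      }
    }

ΠAbelianGroup : ∀ {c ℓ k} → (Fin k → AbelianGroup c ℓ) → AbelianGroup c ℓ
ΠAbelianGroup A = record
  { Carrier        = ∀ i → A.Carrier i
  ; _≈_            = λ x y → ∀ i → A._≈_ i (x i) (y i)
  ; _∙_            = λ x y i → A._∙_ i (x i) (y i)
  ; ε              = λ i → A.ε i
  ; _⁻¹            = λ x i → A._⁻¹ i (x i)
  ; isAbelianGroup = record
    { isGroup = record
      { isMonoid = record
        { isSemigroup = record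
          { isMagma = record
            { isEquivalence = record
              { refl  = λ i → A.refl i
              ; sym   = λ x≈y i → A.sym i (x≈y i)
              ; trans = λ x≈y y≈z i → A.trans i (x≈y i) (y≈z i)
              }
            ; ∙-cong = λ x≈y u≈v i → A.∙-cong i (x≈y i) (u≈v i)
            }
          ; assoc = λ x y z i → A.assoc i (x i) (y i) (z i)
          }
        ; identity = (λ x i → A.identityˡ i (x i)) , (λ x i → A.identityʳ i (x i))
        }
      ; inverse = (λ x i → A.inverseˡ i (x i)) , (λ x i → A.inverseʳ i (x i))
      ; ⁻¹-cong = λ x≈y i → A.⁻¹-cong i (x≈y i)
      }
    ; comm = λ x y i → A.comm i (x i) (y i)
    }
  }
  where module A i = AbelianGroup (A i)

------------------------------------------------------------------------

oddPrime⇒≥3 : ∀ {p} → Prime p → 2 ∤ p → 3 ≤ p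
oddPrime⇒≥3 pp 2∤p with m≤n⇒m<n∨m≡n (nonTrivial⇒n>1 _ {{prime⇒nonTrivial pp}})
... | inj₁ 2<p  = 2<p
... | inj₂ refl = contradiction ∣-refl 2∤p

{-# OPTIONS --safe #-}

-- The identity labelling works.  In C_n the neighbours of x are x ± 1, so the weight
-- of x is 2x.  In the product, the j-th coordinate of a neighbour of x that moves
-- coordinate i is x_j ± 1 if i = j and x_j otherwise; so each of the k directions
-- contributes 2x_j, and the j-th coordinate of the weight is 2k x_j = 2x_j, because
-- n_j divides k - 1.  Doubling is injective since n_j is odd.

module Submission where

open import Defs
open import Algebra.Bundles using (AbelianGroup; Monoid)
import Algebra.Properties.CommutativeMonoid.Mult as CommutativeMonoidMult
import Algebra.Properties.Group as GroupProperties
import Algebra.Properties.Monoid.Mult as MonoidMult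
open import Data.Fin.Base using (Fin; zero; suc; toℕ)
import Data.Fin.Properties as Fin
open import Data.List.Base using (List; []; _∷_; _++_; map; foldr; concat; tabulate)
open import Data.List.Properties using (foldr-++; map-id)
import Data.List.Membership.Setoid as Membership
open import Data.List.Membership.Setoid.Properties
  using (∈-∃++; ∈-resp-≈; ∈-map⁺; ∈-map⁻; ∈-filter⁺; ∈-filter⁻; ∈-concat⁺; ∈-concat⁻; All[≉]⇒∉)
import Data.List.Relation.Binary.Permutation.Setoid as Permutation
import Data.List.Relation.Binary.Permutation.Setoid.Properties as Permutationₚ
open import Data.List.Relation.Unary.All using ([]; _∷_)
open import Data.List.Relation.Unary.All.Properties as All using ()
open import Data.List.Relation.Unary.AllPairs using ([]; _∷_)
open import Data.List.Relation.Unary.AllPairs.Properties as AllPairs using ()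
open import Data.List.Relation.Unary.Any using (here; there)
open import Data.List.Relation.Unary.Any.Properties as Any using ()
open import Data.List.Relation.Unary.Unique.Setoid using (Unique)
import Data.List.Relation.Unary.Unique.Setoid.Properties as Unique
open import Data.Nat.Base using (ℕ; zero; suc; _+_; _*_; _∸_; _≤_; z≤n; s≤s; NonZero)
open import Data.Nat.DivMod using (_%_; _mod_; m<n⇒m%n≡m)
open import Data.Nat.Divisibility
  using (_∣_; _∤_; divides; ∣-refl; ∣m∣n⇒∣m+n; ∣m⇒∣m*n; m∣m*n; n∣m⇒m%n≡0; _∣0)
open import Data.Nat.Primality using (Prime; prime⇒nonZero)
open import Data.Nat.Properties using (≤-trans; *-comm; +-identityʳ; m+n∸n≡m; m≤n+m)
open import Data.Product.Base using (_×_; _,_; proj₁; proj₂)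
open import Data.Sum.Base using (inj₁; inj₂)
open import Function.Base using (_∘_; id)
open import Function.Bundles using (Bijection)
import Function.Construct.Identity as Identity
open import Relation.Binary.Bundles using (Setoid)
open import Relation.Binary.PropositionalEquality
  using (_≡_; _≢_; refl; sym; trans; cong; cong₂; subst; module ≡-Reasoning)
import Relation.Binary.Reasoning.Setoid as ≈-Reasoning
open import Relation.Nullary.Decidable using (yes; no)
open import Relation.Nullary.Negation using (¬_; contradiction)

-- Duplicate-free lists with the same members

module _ {c ℓ} (S : Setoid c ℓ) where
  private module S = Setoid S
  open Membership S using (_∈_)
  open Permutation S

  -- A weight is a sum over a filtered vertex list; this allows any other duplicate-free listing of
  -- the neighbours to be summed instead.
  unique∧⊆∧⊇⇒↭ : ∀ {xs ys} → Unique S xs → Unique S ys →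
                 (∀ {v} → v ∈ xs → v ∈ ys) → (∀ {v} → v ∈ ys → v ∈ xs) → xs ↭ ys
  unique∧⊆∧⊇⇒↭ {[]} {[]} _ _ _ _ = ↭-refl
  unique∧⊆∧⊇⇒↭ {[]} {y ∷ ys} _ _ _ ⊇ = contradiction (⊇ (here S.refl)) λ ()
  unique∧⊆∧⊇⇒↭ {x ∷ xs} {ys} (x∉xs ∷ xs!) ys! ⊆ ⊇
    -- Shifting the occurrence of `x` to the front of `ys` leaves `as ++ bs`. Since `x` repeats in
    -- neither list, the tails again have the same members.
    with as , bs , w , x≈w , ys≋ ← ∈-∃++ S (⊆ (here S.refl))
    with ys↭ ← ↭-transˡ-≋ ys≋ (Permutationₚ.shift S (S.sym x≈w) as bs)
    with x∉zs ∷ zs! ← Permutationₚ.Unique-resp-↭ S ys↭ ys!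
    = ↭-trans (↭-prep x (unique∧⊆∧⊇⇒↭ xs! zs! xs⊆zs zs⊆xs)) (↭-sym ys↭)
    where
    xs⊆zs : ∀ {v} → v ∈ xs → v ∈ as ++ bs
    xs⊆zs v∈xs with Permutationₚ.∈-resp-↭ S ys↭ (⊆ (there v∈xs))
    ... | here v≈x   = contradiction (∈-resp-≈ S v≈x v∈xs) (All[≉]⇒∉ S x∉xs)
    ... | there v∈zs = v∈zs

    zs⊆xs : ∀ {v} → v ∈ as ++ bs → v ∈ xs
    zs⊆xs v∈zs with ⊇ (Permutationₚ.∈-resp-↭ S (↭-sym ys↭) (there v∈zs))
    ... | here v≈x   = contradiction (∈-resp-≈ S v≈x v∈zs) (All[≉]⇒∉ S x∉zs)
    ... | there v∈xs = v∈xs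

-- Sums over concatenated lists

module _ {c ℓ} (M : Monoid c ℓ) where
  open Monoid M renaming (refl to ≈-refl; sym to ≈-sym)
  open MonoidMult M renaming (_×_ to _·_)
  open ≈-Reasoning setoid

  foldr-∙ : ∀ xs y → foldr _∙_ y xs ≈ foldr _∙_ ε xs ∙ y
  foldr-∙ []       y = ≈-sym (identityˡ y)
  foldr-∙ (x ∷ xs) y = begin
    x ∙ foldr _∙_ y xs          ≈⟨ ∙-congˡ (foldr-∙ xs y) ⟩
    x ∙ (foldr _∙_ ε xs ∙ y)    ≈⟨ assoc x _ y ⟨
    (x ∙ foldr _∙_ ε xs) ∙ y    ∎

  -- Meant for one list per direction of a product, all directions having the same sum. Splitting
  -- off the first list leaves an induction on `k`.
  foldr-concat-const : ∀ {k} (xs : Fin k → List Carrier) s → (∀ i → foldr _∙_ ε (xs i) ≈ s) →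
                       foldr _∙_ ε (concat (tabulate xs)) ≈ k · s
  foldr-concat-const {zero}  xs s eq = ≈-refl
  foldr-concat-const {suc k} xs s eq = begin
    foldr _∙_ ε (xs zero ++ rest)             ≡⟨ foldr-++ _∙_ ε (xs zero) rest ⟩
    foldr _∙_ (foldr _∙_ ε rest) (xs zero)    ≈⟨ foldr-∙ (xs zero) _ ⟩
    foldr _∙_ ε (xs zero) ∙ foldr _∙_ ε rest
      ≈⟨ ∙-cong (eq zero) (foldr-concat-const (xs ∘ suc) s (eq ∘ suc)) ⟩
    s ∙ k · s                                 ∎
    where rest = concat (tabulate (xs ∘ suc))

-- Neighbourhoods and weights

module _ (G : FiniteGraph) where
  open FiniteGraph G
  open Membership vertexSetoid using (_∈_)

  record IsNeighbourhood (x : Vertex) (ys : List Vertex) : Set where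
    field
      distinct : Unique vertexSetoid ys
      sound    : ∀ {y} → y ∈ ys → Adjacent x y
      complete : ∀ {y} → Adjacent x y → y ∈ ys

  module _ {a ℓ} (A : AbelianGroup a ℓ) (f : Labelling G A) where
    private module A = AbelianGroup A
    open IsNeighbourhood

    -- Both listings are duplicate-free with the same members, hence permutations of each other, and
    -- a sum in an Abelian group ignores order.
    weight-IsNeighbourhood : ∀ {x ys} → IsNeighbourhood x ys →
      weight G A f x A.≈ foldr A._∙_ A.ε (map (Bijection.to f) ys)
    weight-IsNeighbourhood {x} ys-nbhd =
      Permutationₚ.foldr-commMonoid A.setoid A.isCommutativeMonoid
        (Permutationₚ.map⁺ vertexSetoid A.setoid (Bijection.cong f)
          (unique∧⊆∧⊇⇒↭ vertexSetoid
            (Unique.filter⁺ vertexSetoid (adjacent? x) unique)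
            (distinct ys-nbhd)
            (λ v∈ → complete ys-nbhd (proj₂
              (∈-filter⁻ vertexSetoid (adjacent? x) (proj₁ adjacent-resp) {xs = vertices} v∈)))
            (λ v∈ → ∈-filter⁺ vertexSetoid (adjacent? x) (proj₁ adjacent-resp)
              (enumeration _) (sound ys-nbhd v∈))))

-- Neighbourhoods in a Cartesian product

-- Recursion on the index, instead of a decision `j ≟ i`, avoids transporting the new value between
-- the types `V i` and `V j`.
_[_≔_] : ∀ {k} {V : Fin k → Set} → (∀ i → V i) → ∀ i → V i → ∀ j → V j
(x [ zero  ≔ y ]) zero    = y
(x [ zero  ≔ y ]) (suc j) = x (suc j)
(x [ suc i ≔ y ]) zero    = x zero
(x [ suc i ≔ y ]) (suc j) = ((x ∘ suc) [ i ≔ y ]) j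

[≔]-updated : ∀ {k} {V : Fin k → Set} (x : ∀ i → V i) i y → (x [ i ≔ y ]) i ≡ y
[≔]-updated x zero    y = refl
[≔]-updated x (suc i) y = [≔]-updated (x ∘ suc) i y

[≔]-minimal : ∀ {k} {V : Fin k → Set} (x : ∀ i → V i) i y j → j ≢ i → (x [ i ≔ y ]) j ≡ x j
[≔]-minimal x zero    y zero    j≢i = contradiction refl j≢i
[≔]-minimal x zero    y (suc j) j≢i = refl
[≔]-minimal x (suc i) y zero    j≢i = refl
[≔]-minimal x (suc i) y (suc j) j≢i = [≔]-minimal (x ∘ suc) i y j (j≢i ∘ cong suc)

module _ {k} (G : Fin k → FiniteGraph) where
  private
    module G i = FiniteGraph (G i)
    module S i = Setoid (G.vertexSetoid i)
    S□ = FiniteGraph.vertexSetoid (□ G)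
  open Membership S□ using (_∈_)
  open IsNeighbourhood

  □-neighbourhood : (∀ i → G.Vertex i) → (∀ i → List (G.Vertex i)) → List (∀ i → G.Vertex i)
  □-neighbourhood x yss = concat (tabulate λ i → map (x [ i ≔_]) (yss i))

  -- A neighbour of `x` moves exactly one coordinate, to a neighbour in that factor, so the listing
  -- splits into pairwise disjoint directions.
  □-isNeighbourhood : ∀ x {yss} → (∀ i → IsNeighbourhood (G i) (x i) (yss i)) →
                      IsNeighbourhood (□ G) x (□-neighbourhood x yss)
  □-isNeighbourhood x {yss} nbhd = record
    { distinct = Unique.concat⁺ S□
        (All.tabulate⁺ λ i →
          Unique.map⁺ (G.vertexSetoid i) S□ ([≔]-injective i) (distinct (nbhd i)))
        (AllPairs.tabulate⁺ disjoint)
    ; sound    = λ v∈ →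
        let i , v∈i = Any.tabulate⁻ (∈-concat⁻ S□ (tabulate directions) v∈)
        in i , ∈-direction i v∈i
    ; complete = λ {v} (i , adj , fixed) → ∈-concat⁺ S□ (Any.tabulate⁺ i
        (∈-resp-≈ S□
          (λ j → S.sym j (≈-update i v fixed j))
          (∈-map⁺ (G.vertexSetoid i) S□ ([≔]-cong i) (complete (nbhd i) adj))))
    }
    where
    directions : Fin k → List (∀ i → G.Vertex i)
    directions i = map (x [ i ≔_]) (yss i)

    [≔]-injective : ∀ i {y z} → (∀ j → G._≈_ j ((x [ i ≔ y ]) j) ((x [ i ≔ z ]) j)) → G._≈_ i y z
    [≔]-injective i {y} {z} eq =
      S.trans i (S.reflexive i (sym ([≔]-updated x i y)))
        (S.trans i (eq i) (S.reflexive i ([≔]-updated x i z)))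

    ≈-update : ∀ i v → (∀ j → j ≢ i → G._≈_ j (x j) (v j)) →
               ∀ j → G._≈_ j (v j) ((x [ i ≔ v i ]) j)
    ≈-update i v fixed j with j Fin.≟ i
    ... | yes refl = S.reflexive j (sym ([≔]-updated x j (v j)))
    ... | no  j≢i  = S.trans j (S.sym j (fixed j j≢i))
                       (S.reflexive j (sym ([≔]-minimal x i (v i) j j≢i)))

    [≔]-cong : ∀ i {y z} → G._≈_ i y z → ∀ j → G._≈_ j ((x [ i ≔ y ]) j) ((x [ i ≔ z ]) j)
    [≔]-cong i {y} {z} y≈z j with j Fin.≟ i
    ... | yes refl = S.trans j (S.reflexive j ([≔]-updated x j y))
                       (S.trans j y≈z (S.reflexive j (sym ([≔]-updated x j z))))
    ... | no  j≢i  = S.reflexive j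
                       (trans ([≔]-minimal x i y j j≢i) (sym ([≔]-minimal x i z j j≢i)))

    ∈-direction : ∀ i {v} → v ∈ directions i →
                  G.Adjacent i (x i) (v i) × (∀ j → j ≢ i → G._≈_ j (x j) (v j))
    ∈-direction i v∈ with y , y∈ , v≈ ← ∈-map⁻ (G.vertexSetoid i) S□ v∈ =
      proj₁ (G.adjacent-resp i)
        (S.sym i (S.trans i (v≈ i) (S.reflexive i ([≔]-updated x i y))))
        (sound (nbhd i) y∈) ,
      λ j j≢i → S.sym j (S.trans j (v≈ j) (S.reflexive j ([≔]-minimal x i y j j≢i)))

    -- Seen from direction `j`, a common tuple agrees with `x` at coordinate `i`; seen from
    -- direction `i`, it is adjacent to `x` there. The factors are loopless.
    disjoint : ∀ {i j} → i ≢ j → ∀ {v} → ¬ (v ∈ directions i × v ∈ directions j)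
    disjoint {i} {j} i≢j (v∈i , v∈j) =
      G.adjacent-irr i (proj₂ (∈-direction j v∈j) i i≢j) (proj₁ (∈-direction i v∈i))

-- Multiples and doubling in the integers modulo n

2∤n⇒2∣1+n : ∀ n → 2 ∤ n → 2 ∣ suc n
2∤n⇒2∣1+n zero          2∤n = contradiction (2 ∣0) 2∤n
2∤n⇒2∣1+n (suc zero)    2∤n = ∣-refl
2∤n⇒2∣1+n (suc (suc n)) 2∤n =
  ∣m∣n⇒∣m+n ∣-refl (2∤n⇒2∣1+n n (2∤n ∘ ∣m∣n⇒∣m+n ∣-refl))

module _ (n : ℕ) .{{_ : NonZero n}} where
  open AbelianGroup (ℤ/ n)
    using (_∙_; _⁻¹; ε; group; commutativeMonoid; assoc; comm; identityʳ)
  open CommutativeMonoidMult commutativeMonoid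
    using (×-homo-+; ×-distrib-+) renaming (_×_ to _·_)
  open ≡-Reasoning

  -- Reduces repeated addition in the group to multiplication of naturals, where divisibility by `n`
  -- can be applied.
  ·-mod : ∀ m x → m · x ≡ (m * toℕ x) mod n
  ·-mod zero    x = refl
  ·-mod (suc m) x = begin
    x ∙ m · x                           ≡⟨ cong₂ _∙_ (sym (mod-toℕ n x)) (·-mod m x) ⟩
    (toℕ x mod n) ∙ ((m * toℕ x) mod n) ≡⟨ mod-+ n (toℕ x) (m * toℕ x) ⟩
    (toℕ x + m * toℕ x) mod n           ∎

  n∣m⇒m·x≡ε : ∀ {m} → n ∣ m → ∀ x → m · x ≡ ε
  n∣m⇒m·x≡ε {m} n∣m x = trans (·-mod m x)
    (mod-cong n (trans (n∣m⇒m%n≡0 _ n (∣m⇒∣m*n (toℕ x) n∣m)) (sym (n∣m⇒m%n≡0 0 n (n ∣0)))))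

  -- (n + 1) / 2 inverts doubling.
  double-injective : 2 ∤ n → ∀ {x y} → x ∙ x ≡ y ∙ y → x ≡ y
  double-injective 2∤n {x} {y} eq with divides q 1+n≡q*2 ← 2∤n⇒2∣1+n n 2∤n =
    trans (sym (halve x)) (trans (cong (q ·_) eq) (halve y))
    where
    halve : ∀ z → q · (z ∙ z) ≡ z
    halve z = begin
      q · (z ∙ z)         ≡⟨ ×-distrib-+ z z q ⟩
      q · z ∙ q · z       ≡⟨ ×-homo-+ z q q ⟨
      (q + q) · z         ≡⟨ cong (_· z) (trans (m+m≡m*2 q) (sym 1+n≡q*2)) ⟩
      z ∙ n · z           ≡⟨ cong (z ∙_) (n∣m⇒m·x≡ε ∣-refl z) ⟩
      z ∙ ε               ≡⟨ identityʳ z ⟩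
      z                   ∎
      where
      m+m≡m*2 : ∀ m → m + m ≡ m * 2
      m+m≡m*2 m = trans (cong (m +_) (sym (+-identityʳ m))) (*-comm 2 m)

  -- The two neighbours of a vertex on a cycle

  1ₙ : Fin n
  1ₙ = 1 mod n

  1ₙ∙ : ∀ x → 1ₙ ∙ x ≡ suc (toℕ x) mod n
  1ₙ∙ x = trans (cong (1ₙ ∙_) (sym (mod-toℕ n x))) (mod-+ n 1 (toℕ x))

  next⇒≡ : ∀ {x y} → Next n x y → y ≡ 1ₙ ∙ x
  next⇒≡ {x} {y} y≡ = Fin.toℕ-injective
    (trans y≡ (sym (trans (cong toℕ (1ₙ∙ x)) (toℕ-mod n _))))

  ≡⇒next : ∀ {x y} → y ≡ 1ₙ ∙ x → Next n x y
  ≡⇒next {x} refl = trans (cong toℕ (1ₙ∙ x)) (toℕ-mod n _)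

  -- Since `n` is at least 3, the number 2 is its own remainder. This keeps the two neighbours of a
  -- vertex apart.
  1ₙ∙1ₙ≢ε : 3 ≤ n → 1ₙ ∙ 1ₙ ≢ ε
  1ₙ∙1ₙ≢ε n≥3 eq = contradiction 2≡0 λ ()
    where
    2≡0 : 2 ≡ 0
    2≡0 = begin
      2              ≡⟨ m<n⇒m%n≡m n≥3 ⟨
      2 % n          ≡⟨ toℕ-mod n 2 ⟨
      toℕ (2 mod n)  ≡⟨ cong toℕ (trans (sym (mod-+ n 1 1)) eq) ⟩
      toℕ (0 mod n)  ≡⟨ toℕ-mod n 0 ⟩
      0 % n          ≡⟨ n∣m⇒m%n≡0 0 n (n ∣0) ⟩
      0              ∎

  cycleNeighbourhood : Fin n → List (Fin n)
  cycleNeighbourhood x = (1ₙ ∙ x) ∷ (1ₙ ⁻¹ ∙ x) ∷ []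

  -- The steps +1 and -1 cancel.
  Σ-cycleNeighbourhood : ∀ x → foldr _∙_ ε (cycleNeighbourhood x) ≡ x ∙ x
  Σ-cycleNeighbourhood x = begin
    (1ₙ ∙ x) ∙ ((1ₙ ⁻¹ ∙ x) ∙ ε)  ≡⟨ cong₂ _∙_ (comm 1ₙ x) (identityʳ _) ⟩
    (x ∙ 1ₙ) ∙ (1ₙ ⁻¹ ∙ x)        ≡⟨ assoc x 1ₙ _ ⟩
    x ∙ (1ₙ ∙ (1ₙ ⁻¹ ∙ x))        ≡⟨ cong (x ∙_) (\\-leftDividesˡ 1ₙ x) ⟩
    x ∙ x                         ∎
    where open GroupProperties group

cycle-isNeighbourhood : ∀ n (n≥3 : 3 ≤ n) x →
  IsNeighbourhood (Cycle n n≥3) x (cycleNeighbourhood n {{≥3⇒nonZero n≥3}} x)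
cycle-isNeighbourhood n n≥3 x = record
  { distinct = (distinct ∷ []) ∷ [] ∷ []
  ; sound    = λ where
      (here y≡)         → inj₁ (≡⇒next n y≡)
      (there (here y≡)) → inj₂ (≡⇒next n
        (sym (trans (cong (1ₙ n ∙_) y≡) (\\-leftDividesˡ (1ₙ n) x))))
  ; complete = λ where
      (inj₁ next) → here (next⇒≡ n next)
      (inj₂ next) → there (here
        (sym (trans (cong (1ₙ n ⁻¹ ∙_) (next⇒≡ n next)) (\\-leftDividesʳ (1ₙ n) _))))
  }
  where
  instance _ = ≥3⇒nonZero n≥3
  open AbelianGroup (ℤ/ n) using (_∙_; _⁻¹; group; inverseʳ)
  open GroupProperties group using (∙-cancelʳ; \\-leftDividesˡ; \\-leftDividesʳ)

  -- Cancelling `x` turns a coincidence into 1 = -1, that is, 1 + 1 = 0.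
  distinct : 1ₙ n ∙ x ≢ 1ₙ n ⁻¹ ∙ x
  distinct eq = 1ₙ∙1ₙ≢ε n n≥3
    (trans (cong (1ₙ n ∙_) (∙-cancelʳ x _ _ eq)) (inverseʳ (1ₙ n)))

-- The identity labelling of a single cycle

cycle-distanceAntimagic : ∀ n (n≥3 : 3 ≤ n) → 2 ∤ n →
  DistanceAntimagic (Cycle n n≥3) (ℤ/ n {{≥3⇒nonZero n≥3}})
cycle-distanceAntimagic n n≥3 2∤n = f , λ x y x≢y wx≡wy →
  x≢y (double-injective n 2∤n (trans (sym (weight≡ x)) (trans wx≡wy (weight≡ y))))
  where
  instance _ = ≥3⇒nonZero n≥3
  open AbelianGroup (ℤ/ n) using (_∙_)

  f : Labelling (Cycle n n≥3) (ℤ/ n)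
  -- Vertices and group elements are both `Fin n`, compared by `≡`.
  f = Identity.bijection _

  weight≡ : ∀ x → weight (Cycle n n≥3) (ℤ/ n) f x ≡ x ∙ x
  weight≡ x = trans
    (weight-IsNeighbourhood (Cycle n n≥3) (ℤ/ n) f (cycle-isNeighbourhood n n≥3 x))
    (Σ-cycleNeighbourhood n x)

-- The identity labelling of a product of cycles

module _ {c ℓ k} (A : Fin k → AbelianGroup c ℓ) where
  private module A i = AbelianGroup (A i)
  open MonoidMult (AbelianGroup.monoid (ΠAbelianGroup A)) using () renaming (_×_ to _·_)

  -- Allows the divisor `n j` to be used separately in coordinate `j`.
  ·-pointwise : ∀ m x i → (m · x) i ≡ MonoidMult._×_ (A.monoid i) m (x i)
  ·-pointwise zero    x i = refl
  ·-pointwise (suc m) x i = cong (A._∙_ i (x i)) (·-pointwise m x i)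

-- The bound `1 ≤ k` permits matching the number of factors as `suc k`, after which divisibility of
-- the predecessor reads `n i ∣ k`.
□-cycle-distanceAntimagic : ∀ {k} (n : Fin k → ℕ) (n≥3 : ∀ i → 3 ≤ n i) →
  (∀ i → 2 ∤ n i) → 1 ≤ k → (∀ i → n i ∣ k ∸ 1) →
  DistanceAntimagic (□ (λ i → Cycle (n i) (n≥3 i)))
                    (ΠAbelianGroup (λ i → ℤ/ (n i) {{≥3⇒nonZero (n≥3 i)}}))
□-cycle-distanceAntimagic {suc k} n n≥3 2∤n _ n∣k = f , λ x y x≉y wx≈wy →
  x≉y λ j → double-injective (n j) {{nz j}} (2∤n j)
    (trans (sym (weight≈ x j)) (trans (wx≈wy j) (weight≈ y j)))
  where
  nz = λ i → ≥3⇒nonZero (n≥3 i)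
  G  = λ i → Cycle (n i) (n≥3 i)
  A  = λ i → ℤ/ (n i) {{nz i}}
  ΠA = ΠAbelianGroup A
  module A i = AbelianGroup (A i)
  module ΠA = AbelianGroup ΠA
  open MonoidMult ΠA.monoid using () renaming (_×_ to _·_)

  f : Labelling (□ G) ΠA
  f = Identity.bijection _

  double : ΠA.Carrier → ΠA.Carrier
  double x = x ΠA.∙ x

  nbhd : ∀ (x : ΠA.Carrier) i → List (Fin (n i))
  nbhd x i = cycleNeighbourhood (n i) {{nz i}} (x i)

  -- Either coordinate `j` moves, and its two new values sum to twice `x j`, or it stays and is
  -- counted once for each of the two neighbours in direction `i`.
  direction-sum : ∀ x i → foldr ΠA._∙_ ΠA.ε (map (x [ i ≔_]) (nbhd x i)) ΠA.≈ double x
  direction-sum x i j with j Fin.≟ i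
  ... | yes refl = trans
    (cong₂ (λ a b → A._∙_ j a (A._∙_ j b (A.ε j))) ([≔]-updated x j _) ([≔]-updated x j _))
    (Σ-cycleNeighbourhood (n j) {{nz j}} (x j))
  ... | no j≢i = trans
    (cong₂ (λ a b → A._∙_ j a (A._∙_ j b (A.ε j)))
      ([≔]-minimal x i _ j j≢i) ([≔]-minimal x i _ j j≢i))
    (cong (A._∙_ j (x j)) (A.identityʳ j (x j)))

  weight≈ : ∀ x → weight (□ G) ΠA f x ΠA.≈ double x
  weight≈ x = begin
    weight (□ G) ΠA f x
      ≈⟨ weight-IsNeighbourhood (□ G) ΠA f
           (□-isNeighbourhood G x λ i → cycle-isNeighbourhood (n i) (n≥3 i) (x i)) ⟩
    foldr ΠA._∙_ ΠA.ε (map id (□-neighbourhood G x (nbhd x)))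
      ≡⟨ cong (foldr ΠA._∙_ ΠA.ε) (map-id (□-neighbourhood G x (nbhd x))) ⟩
    foldr ΠA._∙_ ΠA.ε (□-neighbourhood G x (nbhd x))
      ≈⟨ foldr-concat-const ΠA.monoid (λ i → map (x [ i ≔_]) (nbhd x i))
           (double x) (direction-sum x) ⟩
    double x ΠA.∙ k · double x
      -- Here `k` is one less than the number of factors, so each `n j` divides it and the extra
      -- multiple vanishes coordinatewise.
      ≈⟨ ΠA.∙-congˡ {double x} (λ j → trans (·-pointwise A k (double x) j)
           (n∣m⇒m·x≡ε (n j) {{nz j}} (n∣k j) (double x j))) ⟩
    double x ΠA.∙ ΠA.ε
      ≈⟨ ΠA.identityʳ (double x) ⟩
    double x ∎
    where open ≈-Reasoning ΠA.setoid

mainTheorem9 : (∀ (n : ℕ) (n≥3 : 3 ≤ n) → 2 ∤ n →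
    DistanceAntimagic (Cycle n n≥3) (ℤ/ n {{≥3⇒nonZero n≥3}}))
    × (∀ (k : ℕ) → 2 ≤ k → (n : Fin k → ℕ) (n≥3 : ∀ i → 3 ≤ n i) →
    (∀ i → 2 ∤ n i) → (∀ i → n i ∣ k ∸ 1) →
    DistanceAntimagic (□ (λ i → Cycle (n i) (n≥3 i)))
    (ΠAbelianGroup (λ i → ℤ/ (n i) {{≥3⇒nonZero (n≥3 i)}})))
    × (∀ (p : ℕ) (p-prime : Prime p) (p-odd : 2 ∤ p) (d : ℕ) → 1 ≤ d →
    DistanceAntimagic (□ {p * d + 1} (λ _ → Cycle p (oddPrime⇒≥3 p-prime p-odd)))
    (ΠAbelianGroup {k = p * d + 1} (λ _ → ℤ/ p {{prime⇒nonZero p-prime}})))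
mainTheorem9 =
  cycle-distanceAntimagic ,
  (λ k k≥2 n n≥3 2∤n n∣k-1 →
    □-cycle-distanceAntimagic n n≥3 2∤n (≤-trans (s≤s z≤n) k≥2) n∣k-1) ,
  -- Non-zeroness is an irrelevant argument of `ℤ/`, so the proof from primality and the one from
  -- `3 ≤ p` give the same group.
  (λ p p-prime p-odd d _ →
    □-cycle-distanceAntimagic {p * d + 1} (λ _ → p) (λ _ → oddPrime⇒≥3 p-prime p-odd)
      (λ _ → p-odd) (m≤n+m 1 (p * d))
      -- One less than the number of factors is `p * d`.
      (λ _ → subst (p ∣_) (sym (m+n∸n≡m (p * d) 1)) (m∣m*n d)))
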